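{- Let $m\in\mathbb{N}$, let $\eta$ be a finite binomid index of length $m$, and let $\tilde\eta$ be its lex-minimal extension, with partial sums $(S_i)_{i\ge1}$ and averages $A_i=S_i/i$. Let $A_{\max}=\max\{A_i\mid 1\le i\le m\}$. If $k\in\{i\in\mathbb{N}\mid i\le m,\ A_i=A_{\max}\}$, then $km(m+1)/2$ is a preperiod of $\tilde\eta$.
   Context: $\mathbb{N}=\{1,2,3,\dots\}$. A sequence $(e_i)_{i\le m}$ of nonnegative integers, where $m\in\mathbb{N}$ (finite sequence of length $m$) or $m=\infty$ (infinite sequence indexed by $\mathbb{N}$), is a binomid index if $\sum_{i=n-k+1}^{n}e_i\ge\sum_{i=1}^k e_i$ for all $k,n\in\mathbb{N}$ with $1\le k\le n\le m$. Every finite binomid index $\eta$ extends to an infinite binomid index having $\eta$ as its initial segment; among all such extensions there is a unique lexicographically minimal one, denoted $\tilde\eta$ and called the lex-minimal extension of $\eta$. The partial sums of $(e_i)_{i\ge1}$ are $S_i=e_1+\dots+e_i$. It is known that $\tilde\eta$ is eventually periodic, i.e. $\tilde\eta=\eta_0(\eta_1)^\infty$ for some finite sequences $\eta_0$ (possibly empty) and $\eta_1$ (nonempty). A nonnegative integer $q$ is a preperiod of $\tilde\eta=(e_i)_{i\ge1}$ if $q=|\eta_0|$ for some such representation, i.e. if $(e_i)_{i>q}$ is purely periodic (preperiods are not required to be minimal). -}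

module Defs where

open import Data.Fin using (Fin; toℕ)
open import Data.Integer using (+_)
open import Data.List using (applyUpTo; take; drop; sum)
import Data.List.Extrema
open import Data.Nat using (ℕ; suc; _+_; _∸_; _≤_; _<_; NonZero)
open import Data.Product using (∃-syntax; _×_)
open import Data.Rational using (ℚ; _/_)
import Data.Rational.Properties as ℚ
open import Data.Vec using (Vec; toList; lookup)
open import Relation.Binary.Bundles using (module DecTotalOrder)
open import Relation.Binary.PropositionalEquality using (_≡_)
open import Relation.Nullary using (¬_)

-- An infinite sequence (eᵢ)_{i≥1} of nonnegative integers. Positions are
-- shifted by one: e j is the term e_{j+1}. The same shift applies to the
-- entries of a vector representing a finite sequence.
Seq : Set
Seq = ℕ → ℕ

-- block e a k = e_{a+1} + … + e_{a+k}
block : Seq → ℕ → ℕ → ℕ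
block e a k = sum (applyUpTo (λ j → e (a + j)) k)

S : Seq → ℕ → ℕ
S e i = block e 0 i

IsBinomidIndex : Seq → Set
IsBinomidIndex e = ∀ k n → 1 ≤ k → k ≤ n → S e k ≤ block e (n ∸ k) k

IsFiniteBinomidIndex : ∀ {m} → Vec ℕ m → Set
IsFiniteBinomidIndex {m} η =
  ∀ k n → 1 ≤ k → k ≤ n → n ≤ m →
    sum (take k (toList η)) ≤ sum (take k (drop (n ∸ k) (toList η)))

_Extends_ : ∀ {m} → Seq → Vec ℕ m → Set
_Extends_ {m} e η = (i : Fin m) → e (toℕ i) ≡ lookup η i

_<lex_ : Seq → Seq → Set
f <lex e = ∃[ n ] ((∀ j → j < n → f j ≡ e j) × f n < e n)

-- Minimality is expressed as "no extension is strictly smaller": _<lex_ is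
-- classically a total order, but the alternative "e ≡ f or e <lex f" is not
-- decidable for infinite sequences.
record IsLexMinExtension {m} (η : Vec ℕ m) (e : Seq) : Set where
  field
    isBinomidIndex : IsBinomidIndex e
    extends        : e Extends η
    minimal        : ∀ f → IsBinomidIndex f → f Extends η → ¬ (f <lex e)

A : Seq → (i : ℕ) → .{{NonZero i}} → ℚ
A e i = (+ S e i) / i

open Data.List.Extrema (DecTotalOrder.totalOrder ℚ.≤-decTotalOrder) using (max)

-- max {Aᵢ ∣ 1 ≤ i ≤ m}. The default value A₁ required by the library's
-- maximum is itself a member of the list when m ≥ 1.
Amax : Seq → ℕ → ℚ
Amax e m = max (A e 1) (applyUpTo (λ j → A e (suc j)) m)

-- Because of the index shift, the terms eᵢ with i > q are e (q + i), i ≥ 0.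
IsPreperiod : Seq → ℕ → Set
IsPreperiod e q = ∃[ p ] (1 ≤ p × (∀ i → e (q + (i + p)) ≡ e (q + i)))

{-# OPTIONS --safe #-}

-- A binomid index is a sequence whose partial sums S are superadditive. If e is
-- a lex-minimal extension of η, then for every n > m some splitting attains
-- S n = S i + S (n - i): otherwise S n could be decreased by one. Hence S n is
-- the total value of a decomposition of n into parts ≤ m, a part j having the
-- value S j. Once n exceeds k (1 + … + m), some part j occurs at least k times;
-- replacing k parts j by j parts k does not decrease the value, because k has
-- maximal average, so S n = S (n - k) + S k. Thus k is a period.
module Submission where

open import Defs
open import Data.Nat using (ℕ; _+_; _*_; _/_; _≤_; NonZero)
open import Data.Vec using (Vec)
open import Relation.Binary.PropositionalEquality using (_≡_)

open import Data.Fin using (toℕ)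
open import Data.Fin.Properties using (toℕ<n)
import Data.Integer as ℤ
import Data.Integer.Properties as ℤ
import Data.List.Extrema
open import Data.List.Relation.Unary.All.Properties using (applyUpTo⁻)
open import Data.Nat
  using (zero; suc; pred; _∸_; _<_; z≤n; s≤s; z<s; >-nonZero; >-nonZero⁻¹)
open import Data.Nat.DivMod using (m*n/n≡m)
open import Data.Nat.Induction using (<-rec)
open import Data.Nat.Properties
open import Data.Nat.Tactic.RingSolver using (solve-∀)
open import Data.Product using (∃-syntax; _×_; _,_)
open import Data.Rational as ℚ using (toℚᵘ; fromℚᵘ)
import Data.Rational.Properties as ℚ
open import Data.Rational.Unnormalised as ℚᵘ using (mkℚᵘ)
import Data.Rational.Unnormalised.Properties as ℚᵘ
open import Relation.Binary.Bundles using (module DecTotalOrder)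
open import Relation.Binary.PropositionalEquality
  using (_≢_; refl; sym; ≢-sym; trans; cong; cong₂; subst; subst₂; module ≡-Reasoning)
open import Relation.Nullary using (¬_; Dec; yes; no; contradiction)

open Data.List.Extrema (DecTotalOrder.totalOrder ℚ.≤-decTotalOrder) using (xs≤max)

-- Partial sums and block sums

S-suc : ∀ e n → S e (suc n) ≡ S e n + e n
S-suc e zero    = +-identityʳ (e 0)
S-suc e (suc n) =
  trans (cong (e 0 +_) (S-suc (λ j → e (suc j)) n)) (sym (+-assoc (e 0) _ _))

S-+ : ∀ e a k → S e (a + k) ≡ S e a + block e a k
S-+ e a zero    = trans (cong (S e) (+-identityʳ a)) (sym (+-identityʳ _))
S-+ e a (suc k) = begin
  S e (a + suc k)                      ≡⟨ cong (S e) (+-suc a k) ⟩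
  S e (suc (a + k))                    ≡⟨ S-suc e (a + k) ⟩
  S e (a + k) + e (a + k)              ≡⟨ cong (_+ e (a + k)) (S-+ e a k) ⟩
  S e a + block e a k + e (a + k)      ≡⟨ +-assoc (S e a) _ _ ⟩
  S e a + (block e a k + e (a + k))    ≡⟨ cong (S e a +_) (S-suc (λ j → e (a + j)) k) ⟨
  S e a + block e a (suc k)            ∎
  where open ≡-Reasoning

-- Weighted sums over multiplicity functions

S-distrib-+ : ∀ (c d w : ℕ → ℕ) n →
  S (λ j → (c j + d j) * w j) n ≡ S (λ j → c j * w j) n + S (λ j → d j * w j) n
S-distrib-+ c d w zero    = refl
S-distrib-+ c d w (suc n)
  rewrite S-suc (λ j → (c j + d j) * w j) n | S-suc (λ j → c j * w j) n
        | S-suc (λ j → d j * w j) n | S-distrib-+ c d w n =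
  rearrange (S (λ j → c j * w j) n) (S (λ j → d j * w j) n) (c n) (d n) (w n)
  where
  rearrange : ∀ x y a b z → x + y + (a + b) * z ≡ x + a * z + (y + b * z)
  rearrange = solve-∀

-- `δ i` serves as the multiplicity function of a decomposition with the single part `suc i`.
δ : ℕ → ℕ → ℕ
δ i j with i ≟ j
... | yes _ = 1
... | no  _ = 0

δ-≡ : ∀ i → δ i i ≡ 1
δ-≡ i with i ≟ i
... | yes _   = refl
... | no  i≢i = contradiction refl i≢i

δ-≢ : ∀ {i j} → i ≢ j → δ i j ≡ 0
δ-≢ {i} {j} i≢j with i ≟ j
... | yes i≡j = contradiction i≡j i≢j
... | no  _   = refl

S-δ-≤ : ∀ (w : ℕ → ℕ) i n → n ≤ i → S (λ j → δ i j * w j) n ≡ 0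
S-δ-≤ w i zero    n≤i = refl
S-δ-≤ w i (suc n) n<i =
  trans (S-suc (λ j → δ i j * w j) n)
    (cong₂ _+_ (S-δ-≤ w i n (<⇒≤ n<i)) (cong (_* w n) (δ-≢ (≢-sym (<⇒≢ n<i)))))

S-δ : ∀ (w : ℕ → ℕ) i n → i < n → S (λ j → δ i j * w j) n ≡ w i
S-δ w i (suc n) (s≤s i≤n) = trans (S-suc (λ j → δ i j * w j) n) (last (i ≟ n))
  where
  last : Dec (i ≡ n) → S (λ j → δ i j * w j) n + δ i n * w n ≡ w i
  last (yes refl) =
    trans (cong₂ _+_ (S-δ-≤ w i i ≤-refl) (cong (_* w i) (δ-≡ i))) (*-identityˡ (w i))
  last (no i≢n)   =
    trans (cong₂ _+_ (S-δ w i n (≤∧≢⇒< i≤n i≢n)) (cong (_* w n) (δ-≢ i≢n))) (+-identityʳ (w i))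

-- Triangular numbers

2*S-suc : ∀ m → S suc m * 2 ≡ m * (m + 1)
2*S-suc zero    = refl
2*S-suc (suc m) = begin
  S suc (suc m) * 2        ≡⟨ cong (_* 2) (S-suc suc m) ⟩
  (S suc m + suc m) * 2    ≡⟨ *-distribʳ-+ 2 (S suc m) (suc m) ⟩
  S suc m * 2 + suc m * 2  ≡⟨ cong (_+ suc m * 2) (2*S-suc m) ⟩
  m * (m + 1) + suc m * 2  ≡⟨ rearrange m ⟩
  suc m * (suc m + 1)      ∎
  where
  open ≡-Reasoning
  rearrange : ∀ m → m * (m + 1) + suc m * 2 ≡ suc m * (suc m + 1)
  rearrange = solve-∀

-- As a sequence, `suc` is 1, 2, 3, ..., so `S suc m` is 1 + ... + m; `2*S-suc` makes the division
-- exact.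
k*m*[m+1]/2 : ∀ k m → k * m * (m + 1) / 2 ≡ k * S suc m
k*m*[m+1]/2 k m = begin
  k * m * (m + 1) / 2    ≡⟨ cong (_/ 2) (*-assoc k m (m + 1)) ⟩
  k * (m * (m + 1)) / 2  ≡⟨ cong (λ t → k * t / 2) (2*S-suc m) ⟨
  k * (S suc m * 2) / 2  ≡⟨ cong (_/ 2) (*-assoc k (S suc m) 2) ⟨
  k * S suc m * 2 / 2    ≡⟨ m*n/n≡m (k * S suc m) 2 ⟩
  k * S suc m            ∎
  where open ≡-Reasoning

-- Binomid indices and superadditive functions

Superadditive : (ℕ → ℕ) → Set
Superadditive s = ∀ a b → s a + s b ≤ s (a + b)

-- The block of length `b` after position `a` has sum `S e (a + b) ∸ S e a`, and the binomid
-- condition bounds it below by `S e b`.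
binomid⇒superadditive : ∀ {e} → IsBinomidIndex e → Superadditive (S e)
binomid⇒superadditive {e} bin a zero = ≤-reflexive (sym (S-+ e a 0))
binomid⇒superadditive {e} bin a b@(suc _) = begin
  S e a + S e b                  ≤⟨ +-monoʳ-≤ (S e a) (bin b (a + b) z<s (m≤n+m b a)) ⟩
  S e a + block e (a + b ∸ b) b  ≡⟨ cong (λ t → S e a + block e t b) (m+n∸n≡m a b) ⟩
  S e a + block e a b            ≡⟨ S-+ e a b ⟨
  S e (a + b)                    ∎
  where open ≤-Reasoning

superadditive⇒binomid : ∀ {e} → Superadditive (S e) → IsBinomidIndex e
superadditive⇒binomid {e} sup k n _ k≤n = +-cancelˡ-≤ (S e a) _ _ (begin
  S e a + S e k        ≤⟨ sup a k ⟩
  S e (a + k)          ≡⟨ S-+ e a k ⟩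
  S e a + block e a k  ∎)
  where
  open ≤-Reasoning
  a = n ∸ k

-- Inverse to `S` on superadditive functions: these are monotone, so the truncated subtraction is
-- exact.
differences : (ℕ → ℕ) → Seq
differences s j = s (suc j) ∸ s j

module _ {s : ℕ → ℕ} (sup : Superadditive s) where

  superadditive⇒≤suc : ∀ n → s n ≤ s (suc n)
  superadditive⇒≤suc n = m+n≤o⇒n≤o (s 1) (sup 1 n)

  superadditive⇒s0≡0 : s 0 ≡ 0
  superadditive⇒s0≡0 = n≤0⇒n≡0
    (+-cancelˡ-≤ (s 0) _ _ (subst (s 0 + s 0 ≤_) (sym (+-identityʳ (s 0))) (sup 0 0)))

  S-differences : ∀ n → S (differences s) n ≡ s n
  S-differences zero    = sym superadditive⇒s0≡0
  S-differences (suc n) =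
    trans (S-suc (differences s) n)
      (trans (cong (_+ differences s n) (S-differences n)) (m+[n∸m]≡n (superadditive⇒≤suc n)))

  differences-binomid : IsBinomidIndex (differences s)
  differences-binomid = superadditive⇒binomid λ a b →
    subst₂ _≤_ (sym (cong₂ _+_ (S-differences a) (S-differences b)))
      (sym (S-differences (a + b))) (sup a b)

  -- Decompositions into parts

  *-superadditive : ∀ c x → c * s x ≤ s (c * x)
  *-superadditive zero    x = z≤n
  *-superadditive (suc c) x = ≤-trans (+-monoʳ-≤ (s x) (*-superadditive c x)) (sup x (c * x))

  -- Here `c j` is the multiplicity of the part `suc j`, so the sums are the value and the weight of
  -- a decomposition.
  Σ-superadditive : ∀ (c : ℕ → ℕ) m →
    S (λ j → c j * s (suc j)) m ≤ s (S (λ j → c j * suc j) m)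
  Σ-superadditive c zero    = z≤n
  Σ-superadditive c (suc m)
    rewrite S-suc (λ j → c j * s (suc j)) m | S-suc (λ j → c j * suc j) m =
    ≤-trans (+-mono-≤ (Σ-superadditive c m) (*-superadditive (c m) (suc m))) (sup _ _)

  -- Pigeonhole: if every part occurred fewer than k times, the total weight
  -- would be at most k (1 + … + m).
  extract-k-copies : ∀ (c : ℕ → ℕ) k m → k * S suc m < S (λ j → c j * suc j) m →
    ∃[ r ] ∃[ i ] (i < m × S (λ j → c j * suc j) m ≡ r + k * suc i
                         × S (λ j → c j * s (suc j)) m ≤ s r + k * s (suc i))
  extract-k-copies c k zero ()
  extract-k-copies c k (suc m) lt
    rewrite S-suc (λ j → c j * s (suc j)) m | S-suc (λ j → c j * suc j) m | S-suc suc m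
    with k ≤? c m
  -- The largest part already occurs `k` times; its other `d` copies and all smaller parts form the
  -- remainder.
  ... | yes k≤c = W + d * suc m , m , ≤-refl , weight , value
    where
    W = S (λ j → c j * suc j) m
    V = S (λ j → c j * s (suc j)) m
    d = c m ∸ k
    split : ∀ x w → x + c m * w ≡ x + d * w + k * w
    split x w = trans (cong (λ t → x + t * w) (sym (m∸n+n≡m k≤c))) (rearrange x d k w)
      where
      rearrange : ∀ x a b w → x + (a + b) * w ≡ x + a * w + b * w
      rearrange = solve-∀
    weight : W + c m * suc m ≡ W + d * suc m + k * suc m
    weight = split W (suc m)
    open ≤-Reasoning
    value : V + c m * s (suc m) ≤ s (W + d * suc m) + k * s (suc m)
    value = begin
      V + c m * s (suc m)                      ≡⟨ split V (s (suc m)) ⟩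
      V + d * s (suc m) + k * s (suc m)        ≤⟨ +-monoˡ-≤ (k * s (suc m)) (+-mono-≤ (Σ-superadditive c m) (*-superadditive d (suc m))) ⟩
      s W + s (d * suc m) + k * s (suc m)      ≤⟨ +-monoˡ-≤ (k * s (suc m)) (sup W (d * suc m)) ⟩
      s (W + d * suc m) + k * s (suc m)        ∎
  -- Fewer than `k` copies of the largest part weigh at most `k * suc m`, so the smaller parts still
  -- exceed their bound.
  ... | no k≰c with extract-k-copies c k m (+-cancelʳ-< (k * suc m) _ _ bound)
    where
    open ≤-Reasoning
    bound : k * S suc m + k * suc m < S (λ j → c j * suc j) m + k * suc m
    bound = begin-strict
      k * S suc m + k * suc m                  ≡⟨ *-distribˡ-+ k (S suc m) (suc m) ⟨
      k * (S suc m + suc m)                    <⟨ lt ⟩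
      S (λ j → c j * suc j) m + c m * suc m    ≤⟨ +-monoʳ-≤ _ (*-monoˡ-≤ (suc m) (<⇒≤ (≰⇒> k≰c))) ⟩
      S (λ j → c j * suc j) m + k * suc m      ∎
  ...   | r , i , i<m , weight , value =
    -- The copies of the largest part, set aside for the recursion, rejoin the remainder.
    r + c m * suc m , i , m<n⇒m<1+n i<m
    , trans (cong (_+ c m * suc m) weight) (+-right-swap r (k * suc i) (c m * suc m))
    , (begin
        V + c m * s (suc m)                            ≤⟨ +-monoˡ-≤ (c m * s (suc m)) value ⟩
        s r + k * s (suc i) + c m * s (suc m)          ≡⟨ +-right-swap (s r) (k * s (suc i)) (c m * s (suc m)) ⟩
        s r + c m * s (suc m) + k * s (suc i)          ≤⟨ +-monoˡ-≤ (k * s (suc i)) (+-monoʳ-≤ (s r) (*-superadditive (c m) (suc m))) ⟩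
        s r + s (c m * suc m) + k * s (suc i)          ≤⟨ +-monoˡ-≤ (k * s (suc i)) (sup r (c m * suc m)) ⟩
        s (r + c m * suc m) + k * s (suc i)            ∎)
    where
    open ≤-Reasoning
    V = S (λ j → c j * s (suc j)) m
    +-right-swap : ∀ a b c → a + b + c ≡ a + c + b
    +-right-swap = solve-∀

-- Lowering one value of a superadditive function

-- The value v at n is continued by v (x - n + 1), steep enough to keep
-- superadditivity beyond n.
truncate : (ℕ → ℕ) → ℕ → ℕ → ℕ → ℕ
truncate s n v x with x <? n
... | yes _ = s x
... | no  _ = (suc x ∸ n) * v

truncate-< : ∀ s n v {x} → x < n → truncate s n v x ≡ s x
truncate-< s n v {x} x<n with x <? n
... | yes _   = refl
... | no  x≮n = contradiction x<n x≮n

truncate-≡ : ∀ s n v → truncate s n v n ≡ v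
truncate-≡ s n v with n <? n
... | yes n<n = contradiction n<n (n≮n n)
... | no  _   = trans (cong (_* v) (m+n∸n≡m 1 n)) (*-identityˡ v)

module _ {s : ℕ → ℕ} (sup : Superadditive s) (n′ v : ℕ)
         (s≤v : ∀ {x} → x < suc n′ → s x ≤ v)
         (split≤v : ∀ {a b} → a < suc n′ → b < suc n′ → a + b ≡ suc n′ → s a + s b ≤ v) where

  private
    n = suc n′

  -- Below `n`, a positive `x` has `s x ≤ v ≤ x * v`; from `n` on, the factor `x ∸ n′` is at most
  -- `x`.
  truncate≤* : ∀ x → truncate s n v x ≤ x * v
  truncate≤* x with x <? n
  truncate≤* zero    | yes _   = ≤-reflexive (superadditive⇒s0≡0 {s = s} sup)
  truncate≤* (suc x) | yes x<n = ≤-trans (s≤v x<n) (m≤m+n v (x * v))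
  truncate≤* x       | no  _   = *-monoˡ-≤ v (m∸n≤m x n′)

  -- From `a` on, each step adds `v`, so `b` steps add `b * v`, which dominates the value at `b` by
  -- `truncate≤*`.
  truncate-+ : ∀ {a} b → ¬ a < n → truncate s n v a + truncate s n v b ≤ truncate s n v (a + b)
  truncate-+ {a} b a≮n with a <? n | a + b <? n
  ... | yes a<n | _       = contradiction a<n a≮n
  ... | no _    | yes a+b<n = contradiction (≤-<-trans (m≤m+n a b) a+b<n) a≮n
  ... | no _    | no _    = begin
    (a ∸ n′) * v + truncate s n v b  ≤⟨ +-monoʳ-≤ ((a ∸ n′) * v) (truncate≤* b) ⟩
    (a ∸ n′) * v + b * v             ≡⟨ *-distribʳ-+ v (a ∸ n′) b ⟨
    (a ∸ n′ + b) * v                 ≡⟨ cong (_* v) (+-∸-comm b n′≤a) ⟨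
    (a + b ∸ n′) * v                 ∎
    where
    open ≤-Reasoning
    n′≤a : n′ ≤ a
    n′≤a = <⇒≤ (≮⇒≥ a≮n)

  truncate-superadditive : Superadditive (truncate s n v)
  truncate-superadditive a b = by-cases (a <? n) (b <? n)
    where
    open ≤-Reasoning

    beyond : ¬ a + b < n → a < n → b < n → s a + s b ≤ truncate s n v (a + b)
    beyond a+b≮n a<n b<n with a + b ≟ n
    ... | yes a+b≡n =
      subst (s a + s b ≤_) (sym (trans (cong (truncate s n v) a+b≡n) (truncate-≡ s n v)))
        (split≤v a<n b<n a+b≡n)
    ... | no  a+b≢n with a + b <? n
    ...   | yes a+b<n = contradiction a+b<n a+b≮n
    -- Strictly past `n` the factor of `v` is at least 2, enough for two values bounded by `v`.
    ...   | no  _     = begin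
      s a + s b           ≤⟨ +-mono-≤ (s≤v a<n) (s≤v b<n) ⟩
      v + v               ≡⟨ cong (v +_) (*-identityˡ v) ⟨
      2 * v               ≡⟨ cong (_* v) (m+n∸n≡m 2 n′) ⟨
      (suc n ∸ n′) * v    ≤⟨ *-monoˡ-≤ v (∸-monoˡ-≤ n′ (≤∧≢⇒< (≮⇒≥ a+b≮n) (≢-sym a+b≢n))) ⟩
      (a + b ∸ n′) * v    ∎

    by-cases : Dec (a < n) → Dec (b < n) → truncate s n v a + truncate s n v b ≤ truncate s n v (a + b)
    by-cases (no a≮n)  _         = truncate-+ b a≮n
    by-cases (yes _)   (no b≮n)  =
      subst₂ _≤_ (+-comm (truncate s n v b) _) (cong (truncate s n v) (+-comm b a)) (truncate-+ a b≮n)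
    by-cases (yes a<n) (yes b<n)
      rewrite truncate-< s n v a<n | truncate-< s n v b<n with a + b <? n in eq
    ... | yes a+b<n = sup a b
    -- The `with` has reduced `truncate` at `a + b` to its linear branch; `unfold` matches `beyond`
    -- to that form.
    ... | no  a+b≮n = subst (s a + s b ≤_) (unfold eq) (beyond a+b≮n a<n b<n)
      where
      unfold : ∀ {x} {p} → (x <? n) ≡ no p → truncate s n v x ≡ (suc x ∸ n) * v
      unfold eq rewrite eq = refl

-- Lex-minimal extensions

module _ {m} .{{_ : NonZero m}} {η : Vec ℕ m} {e : Seq} (lexmin : IsLexMinExtension η e) where

  open IsLexMinExtension lexmin

  private
    s : ℕ → ℕ
    s = S e

    sup : Superadditive s
    sup = binomid⇒superadditive isBinomidIndex

    differences-S : ∀ j → differences s j ≡ e j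
    differences-S j = trans (cong (_∸ s j) (S-suc e j)) (m+n∸m≡n (s j) (e j))

  -- Since `m ≤ n`, the term `e n` lies beyond `η`. If no splitting blocks lowering it by one,
  -- `truncate` continues the altered partial sums superadditively, against minimality.
  splitting-attained : ∀ n → m ≤ n →
    ∃[ a ] ∃[ b ] (a < suc n × b < suc n × a + b ≡ suc n × s a + s b ≡ s (suc n))
  splitting-attained n m≤n with anyUpTo? (λ i → s (suc i) + s (n ∸ i) ≟ s (suc n)) n
  ... | yes (i , i<n , eq) =
    suc i , n ∸ i , s≤s i<n , s≤s (m∸n≤m n i) , cong suc (m+[n∸m]≡n (<⇒≤ i<n)) , eq
  ... | no unattained = contradiction smaller (minimal f (differences-binomid {s = t} t-sup) f-extends)
    where
    v = pred (s (suc n))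

    0<n : 0 < n
    0<n = <-≤-trans (>-nonZero⁻¹ m) m≤n

    split<s : ∀ {a b} → a < suc n → b < suc n → a + b ≡ suc n → s a + s b < s (suc n)
    -- A zero part would force `b` to be `suc n`, which the bound on `b` excludes.
    split<s {zero} _ b<b refl = contradiction b<b (n≮n _)
    split<s {suc i} {b} (s≤s i<n) _ refl = ≤∧≢⇒< (sup (suc i) b) λ eq →
      unattained (i , i<n , trans (cong (λ t → s (suc i) + s t) (m+n∸m≡n i b)) eq)

    split≤v : ∀ {a b} → a < suc n → b < suc n → a + b ≡ suc n → s a + s b ≤ v
    split≤v a<n b<n a+b≡n = <⇒≤pred (split<s a<n b<n a+b≡n)

    s≤v : ∀ {x} → x < suc n → s x ≤ v
    s≤v {zero}  _         = z≤n
    s≤v {suc i} (s≤s i<n) =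
      m+n≤o⇒m≤o (s (suc i))
        (split≤v (s≤s i<n) (s≤s (m∸n≤m n i)) (cong suc (m+[n∸m]≡n (<⇒≤ i<n))))

    -- The predecessor is strictly smaller because `s (suc n)` is positive: it strictly exceeds the
    -- value of the splitting 1 + `n`.
    v<s : v < s (suc n)
    v<s = ≤-reflexive (suc-pred (s (suc n)) {{>-nonZero (≤-<-trans z≤n (split<s (s≤s 0<n) ≤-refl refl))}})

    t = truncate s (suc n) v

    t-sup : Superadditive t
    t-sup = truncate-superadditive sup n v s≤v split≤v

    f : Seq
    f = differences t

    f≡e : ∀ j → j < n → f j ≡ e j
    f≡e j j<n =
      trans (cong₂ _∸_ (truncate-< s (suc n) v (s≤s j<n)) (truncate-< s (suc n) v (m<n⇒m<1+n j<n)))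
        (differences-S j)

    f-extends : f Extends η
    f-extends i = trans (f≡e (toℕ i) (<-≤-trans (toℕ<n i) m≤n)) (extends i)

    smaller : f <lex e
    smaller = n , f≡e , subst₂ _<_
      (sym (cong₂ _∸_ (truncate-≡ s (suc n) v) (truncate-< s (suc n) v ≤-refl)))
      (differences-S n) (∸-monoˡ-< v<s (s≤v ≤-refl))

  -- Strong induction: numbers from 1 to `m` are single parts, and larger ones split without loss by
  -- `splitting-attained`.
  decomposition : ∀ n →
    ∃[ c ] (S (λ j → c j * suc j) m ≡ n × S (λ j → c j * s (suc j)) m ≡ s n)
  decomposition = <-rec _ decompose
    where
    decompose : ∀ n →
      (∀ {a} → a < n → ∃[ c ] (S (λ j → c j * suc j) m ≡ a × S (λ j → c j * s (suc j)) m ≡ s a)) →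
      ∃[ c ] (S (λ j → c j * suc j) m ≡ n × S (λ j → c j * s (suc j)) m ≡ s n)
    -- `δ m` vanishes on all indices below `m`, so it encodes the empty decomposition.
    decompose zero    rec = δ m , S-δ-≤ suc m m ≤-refl , S-δ-≤ (λ j → s (suc j)) m m ≤-refl
    decompose (suc n) rec with n <? m
    ... | yes n<m = δ n , S-δ suc n m n<m , S-δ (λ j → s (suc j)) n m n<m
    ... | no  n≮m with splitting-attained n (≮⇒≥ n≮m)
    ...   | a , b , a<n , b<n , a+b≡n , eq with rec a<n | rec b<n
    ...     | c , weight-c , value-c | d , weight-d , value-d =
      -- Multiplicities add when the decompositions of `a` and `b` are united.
      (λ j → c j + d j)
      , trans (S-distrib-+ c d suc m) (trans (cong₂ _+_ weight-c weight-d) a+b≡n)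
      , trans (S-distrib-+ c d (λ j → s (suc j)) m) (trans (cong₂ _+_ value-c value-d) eq)

  -- The hypothesis on `k` is maximality of its average with denominators cleared. Positivity of `k`
  -- makes `n + k` strictly exceed the pigeonhole bound.
  S-+k : ∀ k .{{_ : NonZero k}} → (∀ i → i < m → k * s (suc i) ≤ suc i * s k) →
    ∀ n → k * S suc m ≤ n → s (n + k) ≡ s n + s k
  S-+k k avg n q≤n with decomposition (n + k)
  ... | c , weight , value
    with extract-k-copies sup c k m (subst (k * S suc m <_) (sym weight)
           (≤-<-trans q≤n (m<m+n n (>-nonZero⁻¹ k))))
  ...   | r , i , i<m , weight′ , value≤ = ≤-antisym upper (sup n k)
    where
    open ≤-Reasoning
    -- Of the `suc i` parts `k` obtained by the exchange, one is split off and the other `i` join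
    -- `r`, for total weight `n`.
    r+i*k≡n : r + i * k ≡ n
    r+i*k≡n = +-cancelʳ-≡ k _ _ (trans (rearrange r i k) (trans (sym weight′) weight))
      where
      rearrange : ∀ r i k → r + i * k + k ≡ r + k * suc i
      rearrange = solve-∀
    upper : s (n + k) ≤ s n + s k
    upper = begin
      s (n + k)                           ≡⟨ value ⟨
      S (λ j → c j * s (suc j)) m         ≤⟨ value≤ ⟩
      s r + k * s (suc i)                 ≤⟨ +-monoʳ-≤ (s r) (avg i i<m) ⟩
      s r + (s k + i * s k)               ≡⟨ rearrange (s r) (s k) (i * s k) ⟩
      s r + i * s k + s k                 ≤⟨ +-monoˡ-≤ (s k) (+-monoʳ-≤ (s r) (*-superadditive {s = s} sup i k)) ⟩
      s r + s (i * k) + s k               ≤⟨ +-monoˡ-≤ (s k) (sup r (i * k)) ⟩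
      s (r + i * k) + s k                 ≡⟨ cong (λ t → s t + s k) r+i*k≡n ⟩
      s n + s k                           ∎
      where
      rearrange : ∀ x y z → x + (y + z) ≡ x + z + y
      rearrange = solve-∀

-- Comparison of averages

/-cross-mul-≤ : ∀ a b i k → (ℤ.+ a) ℚ./ suc i ℚ.≤ (ℤ.+ b) ℚ./ suc k → a * suc k ≤ b * suc i
/-cross-mul-≤ a b i k le =
  -- Normalisation may cancel common factors; the order on unnormalised rationals is
  -- cross-multiplication itself.
  ℤ.drop‿+≤+ (subst₂ ℤ._≤_ (sym (ℤ.pos-* a (suc k))) (sym (ℤ.pos-* b (suc i))) (ℚᵘ.drop-*≤* (begin
    p                    ≃⟨ ℚ.toℚᵘ-fromℚᵘ p ⟨
    toℚᵘ (fromℚᵘ p)      ≤⟨ ℚ.toℚᵘ-mono-≤ le ⟩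
    toℚᵘ (fromℚᵘ q)      ≃⟨ ℚ.toℚᵘ-fromℚᵘ q ⟩
    q                    ∎)))
  where
  open ℚᵘ.≤-Reasoning
  p = mkℚᵘ (ℤ.+ a) i
  q = mkℚᵘ (ℤ.+ b) k

A≡Amax⇒average-≤ : ∀ e m k .{{_ : NonZero k}} → A e k ≡ Amax e m →
  ∀ i → i < m → k * S e (suc i) ≤ suc i * S e k
A≡Amax⇒average-≤ e m k@(suc k′) A≡Amax i i<m =
  subst₂ _≤_ (*-comm (S e (suc i)) k) (*-comm (S e k) (suc i))
    (/-cross-mul-≤ (S e (suc i)) (S e k) i k′ (subst (A e (suc i) ℚ.≤_) (sym A≡Amax)
      (applyUpTo⁻ (λ j → A e (suc j)) m (xs≤max (A e 1) _) i<m)))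

-- Eventual periodicity

theorem3p5 : (m : ℕ) .{{_ : NonZero m}} (η : Vec ℕ m) → IsFiniteBinomidIndex η →
    (η̃ : Seq) → IsLexMinExtension η η̃ →
    (k : ℕ) .{{_ : NonZero k}} → k ≤ m → A η̃ k ≡ Amax η̃ m →
    IsPreperiod η̃ (k * m * (m + 1) / 2)
theorem3p5 m η _ e lexmin k _ A≡Amax = k , >-nonZero⁻¹ k , periodic
  where
  q = k * m * (m + 1) / 2

  S-+k′ : ∀ n → q ≤ n → S e (n + k) ≡ S e n + S e k
  S-+k′ n q≤n = S-+k lexmin k (A≡Amax⇒average-≤ e m k A≡Amax) n (subst (_≤ n) (k*m*[m+1]/2 k m) q≤n)

  periodic : ∀ i → e (q + (i + k)) ≡ e (q + i)
  -- Subtracting `S-+k′` at `n` from `S-+k′` at `suc n` leaves the equality of terms.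
  periodic i = trans (cong e (sym (+-assoc q i k))) (+-cancelˡ-≡ (S e (n + k)) _ _ (begin
    S e (n + k) + e (n + k)  ≡⟨ S-suc e (n + k) ⟨
    S e (suc n + k)          ≡⟨ S-+k′ (suc n) (m≤n⇒m≤1+n q≤n) ⟩
    S e (suc n) + S e k      ≡⟨ cong (_+ S e k) (S-suc e n) ⟩
    S e n + e n + S e k      ≡⟨ rearrange (S e n) (e n) (S e k) ⟩
    S e n + S e k + e n      ≡⟨ cong (_+ e n) (S-+k′ n q≤n) ⟨
    S e (n + k) + e n        ∎))
    where
    open ≡-Reasoning
    n = q + i
    q≤n : q ≤ n
    q≤n = m≤m+n q i
    rearrange : ∀ x y z → x + y + z ≡ x + z + y
    rearrange = solve-∀
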